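{- Fix $\varepsilon>0$. There is a constant $C=C(\varepsilon)$ such that every Latin square of order $n$ has a minimal cover of size at least $3n-C n^{1/2+\varepsilon}$; that is, every Latin square of order $n$ has a minimal cover of size $3n-O(n^{1/2+\varepsilon})$.
   Context: A Latin square of order $n$ is an $n\times n$ array on $n$ symbols in which each symbol occurs once in each row and each column; its entries are the triples $(i,j,L_{ij})$. A line is the set of all entries in a given row, in a given column, or with a given symbol. A cover is a set of entries meeting every line. A cover $\mathscr{C}$ is minimal if for every entry $\mathbf{e}\in\mathscr{C}$ the set $\mathscr{C}\setminus\{\mathbf{e}\}$ is not a cover. -}

module Defs where

open import Data.Nat using (ℕ; suc; _+_; _*_; _∸_; _^_; _≤_)
open import Data.Fin using (Fin; _≟_)
open import Data.Product using (Σ; ∃; ∃-syntax; _×_; _,_; proj₁; proj₂)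
open import Data.Product.Properties using (≡-dec)
open import Data.List using (List; length; filter)
open import Data.List.Membership.Propositional using (_∈_)
open import Data.List.Relation.Unary.Unique.Propositional using (Unique)
open import Relation.Binary.PropositionalEquality using (_≡_)
open import Relation.Nullary using (¬_; ¬?)

record LatinSquare (n : ℕ) : Set where
  field
    L       : Fin n → Fin n → Fin n
    rowEx   : ∀ i s → ∃[ j ] L i j ≡ s
    rowUniq : ∀ i j j' → L i j ≡ L i j' → j ≡ j'
    colEx   : ∀ j s → ∃[ i ] L i j ≡ s
    colUniq : ∀ j i i' → L i j ≡ L i' j → i ≡ i'
open LatinSquare public

-- An entry (i , j , L i j) is determined by its cell (i , j).
Cell : ℕ → Set
Cell n = Fin n × Fin n

-- A set of entries, represented as a duplicate-free list of cells.
-- It is a cover if it meets every row, every column and every symbol line.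
IsCover : ∀ {n} → LatinSquare n → List (Cell n) → Set
IsCover {n} Q C =
    (∀ (i : Fin n) → ∃[ e ] (e ∈ C × proj₁ e ≡ i))
  × (∀ (j : Fin n) → ∃[ e ] (e ∈ C × proj₂ e ≡ j))
  × (∀ (s : Fin n) → ∃[ e ] (e ∈ C × L Q (proj₁ e) (proj₂ e) ≡ s))

remove : ∀ {n} → Cell n → List (Cell n) → List (Cell n)
remove e C = filter (λ x → ¬? (≡-dec _≟_ _≟_ e x)) C

IsMinimalCover : ∀ {n} → LatinSquare n → List (Cell n) → Set
IsMinimalCover Q C =
  Unique C × IsCover Q C × (∀ e → e ∈ C → ¬ IsCover Q (remove e C))

-- For ε = p / q (p , q ≥ 1), constant C ∈ ℕ, order n, size s:
--   s ≥ 3n − C · n^(1/2 + p/q)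
-- ⇔ (3n ∸ s) ≤ C · n^((q + 2p)/(2q))
-- ⇔ (3n ∸ s)^(2q) ≤ C^(2q) · n^(q + 2p)      (all quantities nonnegative)
SizeBound : (p q C n s : ℕ) → Set
SizeBound p q C n s = (3 * n ∸ s) ^ (2 * q) ≤ C ^ (2 * q) * n ^ (q + 2 * p)

{-# OPTIONS --safe #-}
-- Fix sets of hub rows, columns and symbols, and let D consist of the entries that meet at
-- least two hub lines.  If D is a cover, every minimal cover contained in D has at least
-- 3n − #hubs entries, since each of its entries meets at most one line that is not a hub.
--
-- Hubs with D a cover: let K be a set of k ≈ √n indices.  Taking K as hub columns, every
-- symbol lies in K in k different rows, so greedily picking rows leaves at most half of the
-- symbols unmet after O(n / k) steps, and none after O((n / k) log n) steps.  Add these rows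
-- and the rows K as hubs.  The hub symbols are obtained in the same way: they meet the k
-- symbols each row has in the columns K, and the k symbols each column has in the rows K.
-- This uses O(√n log n) hubs.
module Submission where

open import Defs
open import Data.Nat using (ℕ; suc)
open import Data.Product using (∃-syntax; _×_)
open import Data.List using (List; length)

open import Data.Nat
  using (zero; _+_; _*_; _∸_; _^_; _⊓_; _≤_; _<_; z≤n; s≤s; _≤?_; NonZero; >-nonZero; _/_; _%_)
open import Data.Nat.Properties hiding (_≟_)
open import Data.Nat.DivMod using (m≡m%n+[m/n]*n; m%n<n; m/n*n≤m)
open import Data.Nat.Tactic.RingSolver using (solve-∀)
open import Data.Nat.ListAction using (sum)
open import Data.Fin using (Fin; zero; suc; _≟_; remQuot; combine)
open import Data.Fin.Patterns using (0F; 1F; 2F)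
open import Data.Fin.Properties using (all?; combine-remQuot)
open import Data.Product using (_,_; proj₁; proj₂; uncurry; map₂)
open import Data.Product.Properties using (≡-dec)
open import Data.Sum using (_⊎_; inj₁; inj₂)
open import Data.List using ([]; _∷_; _++_; map; filter; take; allFin; tabulate; cartesianProduct)
open import Data.List.Properties
  using (length-map; length-++; length-tabulate; length-take; filter-notAll)
open import Data.List.Membership.Propositional using (_∈_; find; lose)
open import Data.List.Membership.Propositional.Properties
import Data.List.Membership.DecPropositional as DecMembership
open import Data.List.Relation.Unary.Any using (here; there; any?)
open import Data.List.Relation.Unary.All using (lookup)
open import Data.List.Relation.Unary.AllPairs using ([]; _∷_)
open import Data.List.Relation.Unary.Unique.Propositional using (Unique)
import Data.List.Relation.Unary.Unique.Propositional.Properties as Uniqueᵖ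
open import Function using (_∘_; id)
open import Relation.Binary.Definitions using (DecidableEquality)
open import Relation.Binary.PropositionalEquality
  using (_≡_; refl; sym; trans; cong; cong₂; subst)
open import Relation.Nullary using (Dec; yes; no; ¬?; contradiction; _×-dec_; _⊎-dec_)
open import Relation.Nullary.Decidable using (map′)
open import Relation.Unary using (Decidable)

private variable
  A A′ : Set

-- Counting in lists

-- Deleting the head of `xs` from `ys` strictly shortens `ys`, and the tail still embeds because it
-- avoids that head.
unique-⊆⇒length≤ : DecidableEquality A → {xs ys : List A} → Unique xs →
                   (∀ {x} → x ∈ xs → x ∈ ys) → length xs ≤ length ys
unique-⊆⇒length≤ _≟ᴬ_ []                   _     = z≤n
unique-⊆⇒length≤ _≟ᴬ_ {x ∷ xs} {ys} (x∉xs ∷ uxs) xs⊆ys =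
  ≤-<-trans (unique-⊆⇒length≤ _≟ᴬ_ uxs xs⊆ys-x)
            (filter-notAll x≢? ys (lose (xs⊆ys (here refl)) (λ x≢x → x≢x refl)))
  where
  x≢? = λ y → ¬? (x ≟ᴬ y)
  xs⊆ys-x : ∀ {y} → y ∈ xs → y ∈ filter x≢? ys
  xs⊆ys-x y∈xs = ∈-filter⁺ x≢? (xs⊆ys (there y∈xs)) (lookup x∉xs y∈xs)

module _ {P : A → Set} (P? : Decidable P) where

  length-filter-¬ : ∀ xs → length (filter P? xs) + length (filter (¬? ∘ P?) xs) ≡ length xs
  length-filter-¬ [] = refl
  length-filter-¬ (x ∷ xs) with P? x
  ... | yes _ = cong suc (length-filter-¬ xs)
  ... | no  _ = trans (+-suc _ _) (cong suc (length-filter-¬ xs))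

+-exchange : ∀ p q r → p + (q + r) ≡ q + (p + r)
+-exchange = solve-∀

module _ {P : A → A′ → Set} (P? : ∀ a → Decidable (P a)) where

  sum-incidences-∷ : ∀ x xs as →
    sum (map (λ a → length (filter (P? a) (x ∷ xs))) as)
      ≡ length (filter (λ a → P? a x) as) + sum (map (λ a → length (filter (P? a) xs)) as)
  sum-incidences-∷ x xs [] = refl
  sum-incidences-∷ x xs (a ∷ as) with P? a x
  ... | yes _ = cong suc (trans (cong (p +_) (sum-incidences-∷ x xs as)) (+-exchange p r s))
    where
    p = length (filter (P? a) xs)
    r = length (filter (λ b → P? b x) as)
    s = sum (map (λ b → length (filter (P? b) xs)) as)
  ... | no  _ = trans (cong (p +_) (sum-incidences-∷ x xs as)) (+-exchange p r s)
    where
    p = length (filter (P? a) xs)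
    r = length (filter (λ b → P? b x) as)
    s = sum (map (λ b → length (filter (P? b) xs)) as)

  -- Both sides compare with the number of pairs `(a , x)` satisfying `P`: each `x` contributes at
  -- least `k` of them, and the right side groups them by `a`.
  double-count : ∀ {k} as → (∀ x → k ≤ length (filter (λ a → P? a x) as)) → ∀ xs →
                 length xs * k ≤ sum (map (λ a → length (filter (P? a) xs)) as)
  double-count as k≤deg [] = z≤n
  double-count as k≤deg (x ∷ xs) rewrite sum-incidences-∷ x xs as =
    +-mono-≤ (k≤deg x) (double-count as k≤deg xs)

-- The witness is a running maximum of `g`; multiplying by the length avoids division.
averaging : (g : A → ℕ) → ∀ a as → ∃[ b ] sum (map g (a ∷ as)) ≤ length (a ∷ as) * g b
averaging g a [] = a , ≤-refl
averaging g a (a′ ∷ as) with averaging g a′ as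
... | b , sum≤ with ≤-total (g a) (g b)
...   | inj₁ a≤b = b , +-mono-≤ a≤b sum≤
...   | inj₂ b≤a = a , +-monoʳ-≤ (g a) (≤-trans sum≤ (*-monoʳ-≤ (length (a′ ∷ as)) b≤a))

-- Hitting sets

-- Each `x` stands for the set of all `f x c` with `c` in `K`, which has `k` elements by
-- injectivity; the aim is a small list meeting all these sets.
module Hitting {m} (f : Fin (suc m) → Fin (suc m) → Fin (suc m))
               (f-injective : ∀ x {c c′} → f x c ≡ f x c′ → c ≡ c′)
               {K : List (Fin (suc m))} (uK : Unique K) where

  n = suc m

  open DecMembership (_≟_ {n}) using (_∈?_)

  HitBy : List (Fin n) → Fin n → Set
  HitBy T x = ∃[ c ] (c ∈ K × f x c ∈ T)

  hits? : ∀ a x → Dec (a ∈ map (f x) K)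
  hits? a x = a ∈? map (f x) K

  k = length K

  k≤degree : ∀ x → k ≤ length (filter (λ a → hits? a x) (allFin n))
  k≤degree x = begin
    length K              ≡⟨ length-map (f x) K ⟨
    length (map (f x) K)  ≤⟨ unique-⊆⇒length≤ _≟_ (Uniqueᵖ.map⁺ (f-injective x) uK)
                               (λ {a} → ∈-filter⁺ (λ a → hits? a x) (∈-allFin a)) ⟩
    _                     ∎
    where open ≤-Reasoning

  popular : ∀ xs → ∃[ a ] length xs * k ≤ n * length (filter (hits? a) xs)
  -- `allFin n` unfolds to `zero ∷ tabulate suc`, the nonempty form that `averaging` expects.
  popular xs with averaging (λ a → length (filter (hits? a) xs)) zero (tabulate suc)
  ... | a , sum≤ rewrite length-tabulate {n = m} (Fin.suc {m}) =
    a , ≤-trans (double-count hits? (allFin n) k≤degree xs) sum≤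

  Covers : List (Fin n) → List (Fin n) → List (Fin n) → Set
  Covers xs T ys = ∀ {x} → x ∈ xs → HitBy T x ⊎ x ∈ ys

  -- While more than half of xs is unhit, a popular element hits at least k ∣xs∣ / 2n further
  -- members, so ∣ys∣ ≤ ∣xs∣ − s k ∣xs∣ / 2n; the bound is cleared of subtraction and division.
  greedy : ∀ xs s → ∃[ T ] ∃[ ys ] (length T ≤ s × Covers xs T ys ×
             (2 * length ys ≤ length xs
               ⊎ s * (length xs * k) + 2 * (n * length ys) ≤ 2 * (n * length xs)))
  greedy xs zero = [] , xs , z≤n , inj₂ , inj₂ ≤-refl
  greedy xs (suc s) with greedy xs s
  ... | T , ys , ∣T∣≤s , cov , inj₁ half = T , ys , m≤n⇒m≤1+n ∣T∣≤s , cov , inj₁ half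
  ... | T , ys , ∣T∣≤s , cov , inj₂ potential with 2 * length ys ≤? length xs
  ...   | yes half = T , ys , m≤n⇒m≤1+n ∣T∣≤s , cov , inj₁ half
  ...   | no ¬half with popular ys
  ...     | a , pop = a ∷ T , zs , s≤s ∣T∣≤s , cov′ , inj₂ potential′
    where
    zs = filter (¬? ∘ hits? a) ys
    h = length (filter (hits? a) ys)

    cov′ : Covers xs (a ∷ T) zs
    cov′ {x} x∈xs with cov x∈xs
    ... | inj₁ (c , c∈K , fxc∈T) = inj₁ (c , c∈K , there fxc∈T)
    ... | inj₂ x∈ys with hits? a x
    ...   | no ¬hit = inj₂ (∈-filter⁺ (¬? ∘ hits? a) x∈ys ¬hit)
    ...   | yes hit with ∈-map⁻ (f x) hit
    ...     | c , c∈K , a≡fxc = inj₁ (c , c∈K , here (sym a≡fxc))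

    M = length xs
    potential′ : suc s * (M * k) + 2 * (n * length zs) ≤ 2 * (n * M)
    potential′ = begin
      suc s * (M * k) + 2 * (n * length zs)                    ≡⟨ eq₁ s (M * k) _ ⟩
      s * (M * k) + (M * k + 2 * (n * length zs))
        ≤⟨ +-monoʳ-≤ (s * (M * k)) (+-monoˡ-≤ _ (*-monoˡ-≤ k (≰⇒≥ ¬half))) ⟩
      s * (M * k) + (2 * length ys * k + 2 * (n * length zs))
        ≡⟨ cong (λ z → s * (M * k) + (z + 2 * (n * length zs))) (*-assoc 2 (length ys) k) ⟩
      s * (M * k) + (2 * (length ys * k) + 2 * (n * length zs))
        ≤⟨ +-monoʳ-≤ (s * (M * k)) (+-monoˡ-≤ _ (*-monoʳ-≤ 2 pop)) ⟩
      s * (M * k) + (2 * (n * h) + 2 * (n * length zs))        ≡⟨ eq₂ (s * (M * k)) n h _ ⟩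
      s * (M * k) + 2 * (n * (h + length zs))
        ≡⟨ cong (λ z → s * (M * k) + 2 * (n * z)) (length-filter-¬ (hits? a) ys) ⟩
      s * (M * k) + 2 * (n * length ys)                        ≤⟨ potential ⟩
      2 * (n * M)                                              ∎
      where
      open ≤-Reasoning
      eq₁ : ∀ s x y → suc s * x + y ≡ s * x + (x + y)
      eq₁ = solve-∀
      eq₂ : ∀ w n h z → w + (2 * (n * h) + 2 * (n * z)) ≡ w + 2 * (n * (h + z))
      eq₂ = solve-∀

  module _ {t} (n≤tk : n ≤ t * k) where

    -- With `n ≤ t * k`, the term `t * (M * k)` of the potential is at least `n * M`. This leaves
    -- `n * (2 * length ys) ≤ n * M`, so the second outcome of `greedy` also means halving.
    hit-half : ∀ xs → ∃[ T ] ∃[ ys ] (length T ≤ t × Covers xs T ys × 2 * length ys ≤ length xs)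
    hit-half xs with greedy xs t
    ... | T , ys , ∣T∣≤t , cov , inj₁ half = T , ys , ∣T∣≤t , cov , half
    ... | T , ys , ∣T∣≤t , cov , inj₂ potential =
      T , ys , ∣T∣≤t , cov , *-cancelˡ-≤ n (+-cancelˡ-≤ (n * M) _ _ bound)
      where
      M = length xs
      bound : n * M + n * (2 * length ys) ≤ n * M + n * M
      bound = begin
        n * M + n * (2 * length ys)        ≤⟨ +-monoˡ-≤ _ (*-monoˡ-≤ M n≤tk) ⟩
        t * k * M + n * (2 * length ys)    ≡⟨ eq₁ t k M n (length ys) ⟩
        t * (M * k) + 2 * (n * length ys)  ≤⟨ potential ⟩
        2 * (n * M)                        ≡⟨ eq₂ (n * M) ⟩
        n * M + n * M                      ∎
        where
        open ≤-Reasoning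
        eq₁ : ∀ t k M n y → t * k * M + n * (2 * y) ≡ t * (M * k) + 2 * (n * y)
        eq₁ = solve-∀
        eq₂ : ∀ x → 2 * x ≡ x + x
        eq₂ = solve-∀

    -- Each halving costs at most `t` elements and lowers the exponent by one. The strict bound
    -- makes the list empty at exponent zero.
    hit-list : ∀ j xs → length xs < 2 ^ j →
               ∃[ T ] (length T ≤ j * t × (∀ {x} → x ∈ xs → HitBy T x))
    hit-list zero [] _ = [] , z≤n , λ ()
    hit-list zero (_ ∷ _) (s≤s ())
    hit-list (suc j) xs xs< with hit-half xs
    ... | T , ys , ∣T∣≤t , cov , half with hit-list j ys (*-cancelˡ-< 2 _ _ (≤-<-trans half xs<))
    ...   | T′ , ∣T′∣≤ , hit′ = T ++ T′
          , ≤-trans (≤-reflexive (length-++ T)) (+-mono-≤ ∣T∣≤t ∣T′∣≤) , hit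
      where
      hit : ∀ {x} → x ∈ xs → HitBy (T ++ T′) x
      hit x∈xs with cov x∈xs
      ... | inj₁ (c , c∈K , fxc∈T) = c , c∈K , ∈-++⁺ˡ fxc∈T
      ... | inj₂ x∈ys with hit′ x∈ys
      ...   | c , c∈K , fxc∈T′ = c , c∈K , ∈-++⁺ʳ T fxc∈T′

    hit-all : ∀ j → n < 2 ^ j → ∃[ T ] (length T ≤ j * t × (∀ x → HitBy T x))
    hit-all j n<2^j with hit-list j (allFin n) (subst (_< 2 ^ j) (sym (length-tabulate {n = n} id)) n<2^j)
    ... | T , ∣T∣≤ , hit = T , ∣T∣≤ , λ x → hit (∈-allFin x)

-- Covers whose entries meet at least two hub lines

-- The tags `0F`, `1F`, `2F` mark rows, columns and symbols.
Line : ℕ → Set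
Line n = Fin 3 × Fin n

_≟ˡ_ : ∀ {n} → DecidableEquality (Line n)
_≟ˡ_ = ≡-dec _≟_ _≟_

allLines : ∀ n → List (Line n)
allLines n = tabulate {n = 3 * n} (remQuot {3} n)

allLines-unique : ∀ n → Unique (allLines n)
allLines-unique n = Uniqueᵖ.tabulate⁺ λ {i} {j} eq →
  trans (sym (combine-remQuot {3} n i)) (trans (cong (uncurry combine) eq) (combine-remQuot {3} n j))

module _ {n} (Q : LatinSquare n) where

  open DecMembership (_≟ˡ_ {n}) using (_∈?_)

  coord : Fin 3 → Cell n → Fin n
  coord 0F (i , j) = i
  coord 1F (i , j) = j
  coord 2F (i , j) = L Q i j

  -- Treats the three kinds of line uniformly: the instances at `0F`, `1F`, `2F` compute to the
  -- three conjuncts of `IsCover`.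
  Meets : List (Cell n) → Fin 3 → Set
  Meets C t = ∀ x → ∃[ e ] (e ∈ C × coord t e ≡ x)

  meets? : ∀ C t → Dec (Meets C t)
  meets? C t = all? λ x → map′ find (λ (e , e∈C , eq) → lose e∈C eq)
                               (any? (λ e → coord t e ≟ x) C)

  isCover? : ∀ C → Dec (IsCover Q C)
  isCover? C = meets? C 0F ×-dec meets? C 1F ×-dec meets? C 2F

  -- Redundant entries are deleted one at a time. `N` bounds the length and serves as fuel, since
  -- every deletion shortens the list.
  minimalSubcover : ∀ N C → length C ≤ N → Unique C → IsCover Q C →
                    ∃[ M ] (IsMinimalCover Q M × (∀ {e} → e ∈ M → e ∈ C))
  minimalSubcover zero [] _ uC cover = [] , (uC , cover , λ _ ()) , id
  minimalSubcover (suc N) C ∣C∣≤ uC cover with any? (λ e → isCover? (remove e C)) C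
  ... | no irredundant = C , (uC , cover , λ e e∈C c → irredundant (lose e∈C c)) , id
  ... | yes redundant with find redundant
  ...   | e , e∈C , cover′ =
    let ≢e? = λ x → ¬? (≡-dec _≟_ _≟_ e x)
        M , min , M⊆ = minimalSubcover N (remove e C)
          (≤-pred (≤-trans (filter-notAll ≢e? C (lose e∈C (λ e≢e → e≢e refl))) ∣C∣≤))
          (Uniqueᵖ.filter⁺ ≢e? uC) cover′
    in M , min , λ x∈M → proj₁ (∈-filter⁻ ≢e? (M⊆ x∈M))

  module _ (H : List (Line n)) where

    Hub : Fin 3 → Cell n → Set
    Hub t e = (t , coord t e) ∈ H

    hub? : ∀ t e → Dec (Hub t e)
    hub? t e = (t , coord t e) ∈? H

    TwoHubs : Cell n → Set
    TwoHubs e = Hub 0F e × Hub 1F e ⊎ Hub 0F e × Hub 2F e ⊎ Hub 1F e × Hub 2F e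

    twoHubs? : Decidable TwoHubs
    twoHubs? e = (hub? 0F e ×-dec hub? 1F e)
           ⊎-dec (hub? 0F e ×-dec hub? 2F e)
           ⊎-dec (hub? 1F e ×-dec hub? 2F e)

    -- For an entry with two hub lines this is its only possible non-hub line. The symbol line is
    -- the default when row and column are hubs, even if it is a hub too.
    privateLine : Cell n → Line n
    privateLine e with hub? 0F e | hub? 1F e
    ... | no _  | _     = 0F , coord 0F e
    ... | yes _ | no _  = 1F , coord 1F e
    ... | yes _ | yes _ = 2F , coord 2F e

    hub-or-private : ∀ {e} → TwoHubs e → ∀ t → Hub t e ⊎ (t , coord t e) ≡ privateLine e
    hub-or-private {e} two t with hub? 0F e | hub? 1F e
    hub-or-private two 0F | no _ | _ = inj₂ refl
    hub-or-private (inj₁ (h₀ , _)) _ | no ¬h₀ | _ = contradiction h₀ ¬h₀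
    hub-or-private (inj₂ (inj₁ (h₀ , _))) _ | no ¬h₀ | _ = contradiction h₀ ¬h₀
    hub-or-private (inj₂ (inj₂ (h₁ , _))) 1F | no _ | _ = inj₁ h₁
    hub-or-private (inj₂ (inj₂ (_ , h₂))) 2F | no _ | _ = inj₁ h₂
    hub-or-private two 0F | yes h₀ | _ = inj₁ h₀
    hub-or-private two 1F | yes _ | no _ = inj₂ refl
    hub-or-private (inj₁ (_ , h₁)) 2F | yes _ | no ¬h₁ = contradiction h₁ ¬h₁
    hub-or-private (inj₂ (inj₁ (_ , h₂))) 2F | yes _ | no _ = inj₁ h₂
    hub-or-private (inj₂ (inj₂ (_ , h₂))) 2F | yes _ | no _ = inj₁ h₂
    hub-or-private two 1F | yes _ | yes h₁ = inj₁ h₁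
    hub-or-private two 2F | yes _ | yes _ = inj₂ refl

    -- Any line is met by some entry of `M`, hence is a hub or the `privateLine` of that entry. So
    -- the `3 * n` distinct lines all occur in `H ++ map privateLine M`.
    cover-size : ∀ M → IsCover Q M → (∀ {e} → e ∈ M → TwoHubs e) → 3 * n ≤ length H + length M
    cover-size M (rows , cols , syms) two = begin
      3 * n                           ≡⟨ length-tabulate {n = 3 * n} (remQuot {3} n) ⟨
      length (allLines n)             ≤⟨ unique-⊆⇒length≤ _≟ˡ_ (allLines-unique n) lines⊆ ⟩
      length (H ++ map privateLine M) ≡⟨ length-++ H ⟩
      length H + length (map privateLine M) ≡⟨ cong (length H +_) (length-map privateLine M) ⟩
      length H + length M             ∎
      where
      open ≤-Reasoning
      meets : ∀ t → Meets M t
      meets 0F = rows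
      meets 1F = cols
      meets 2F = syms
      lines⊆ : ∀ {l} → l ∈ allLines n → l ∈ H ++ map privateLine M
      lines⊆ {t , x} _ with meets t x
      ... | e , e∈M , refl with hub-or-private (two e∈M) t
      ...   | inj₁ hub  = ∈-++⁺ˡ hub
      ...   | inj₂ priv = ∈-++⁺ʳ H (subst (_∈ map privateLine M) (sym priv) (∈-map⁺ privateLine e∈M))

    minimalCover-from-hubs : (∀ t x → ∃[ e ] (TwoHubs e × coord t e ≡ x)) →
                             ∃[ M ] (IsMinimalCover Q M × 3 * n ∸ length M ≤ length H)
    minimalCover-from-hubs dominated =
      let cells = cartesianProduct (allFin n) (allFin n)
          D = filter twoHubs? cells
          meets : ∀ t → Meets D t
          meets t x = let e , two , eq = dominated t x in
            e , ∈-filter⁺ twoHubs? (∈-cartesianProduct⁺ (∈-allFin _) (∈-allFin _)) two , eq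
          M , min@(_ , cover , _) , M⊆D = minimalSubcover (length D) D ≤-refl
            (Uniqueᵖ.filter⁺ twoHubs? (Uniqueᵖ.cartesianProduct⁺ (Uniqueᵖ.allFin⁺ n) (Uniqueᵖ.allFin⁺ n)))
            (meets 0F , meets 1F , meets 2F)
      in M , min , m≤n+o⇒m∸n≤o (3 * n) (length M)
           (≤-trans (cover-size M cover (λ e∈M → proj₂ (∈-filter⁻ twoHubs? {xs = cells} (M⊆D e∈M))))
                    (≤-reflexive (+-comm (length H) (length M))))

-- Hub lines from three hitting sets

minimalCover-deficiency : ∀ {m} (Q : LatinSquare (suc m)) {k j} →
  k ≤ suc m → suc m ≤ 3 * k * k → suc m < 2 ^ j →
  ∃[ M ] (IsMinimalCover Q M × 3 * suc m ∸ length M ≤ 2 * k + 3 * (j * (3 * k)))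
minimalCover-deficiency {m} Q {k} {j} k≤n n≤3kk n<2^j
  -- The sets to hit are, in turn: the rows holding symbol `s` in the columns `K`, the symbols of
  -- row `r` in the columns `K`, and the symbols of column `c` in the rows `K`.
  with Hitting.hit-all (λ s c → proj₁ (colEx Q c s)) rowOf-injective uK n≤tk j n<2^j
     | Hitting.hit-all (L Q) (λ r → rowUniq Q r _ _) uK n≤tk j n<2^j
     | Hitting.hit-all (λ c r → L Q r c) (λ c → colUniq Q c _ _) uK n≤tk j n<2^j
  where
  n = suc m
  K = take k (allFin n)
  uK : Unique K
  uK = Uniqueᵖ.take⁺ k (Uniqueᵖ.allFin⁺ n)
  ∣K∣ : length K ≡ k
  ∣K∣ = trans (length-take k (allFin n))
    (trans (cong (k ⊓_) (length-tabulate {n = n} id)) (m≤n⇒m⊓n≡m k≤n))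
  n≤tk : n ≤ 3 * k * length K
  n≤tk rewrite ∣K∣ = n≤3kk
  -- If `s` sat in the same row in both columns, that row would contain it twice unless the columns
  -- agree.
  rowOf-injective : ∀ s {c c′} → proj₁ (colEx Q c s) ≡ proj₁ (colEx Q c′ s) → c ≡ c′
  rowOf-injective s {c} {c′} eq = rowUniq Q _ c c′
    (trans (proj₂ (colEx Q c s)) (sym (trans (cong (λ r → L Q r c′) eq) (proj₂ (colEx Q c′ s)))))
... | R , ∣R∣≤ , hitR | S , ∣S∣≤ , hitS | S′ , ∣S′∣≤ , hitS′ =
  map₂ (map₂ (λ ≤H → ≤-trans ≤H ∣H∣≤)) (minimalCover-from-hubs Q H dominated)
  where
  n = suc m
  K = take k (allFin n)
  rows cols H : List (Line n)
  rows = map (0F ,_) (K ++ R)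
  cols = map (1F ,_) K
  H = rows ++ cols ++ map (2F ,_) (S ++ S′)

  row∈ : ∀ {r} → r ∈ K ++ R → (0F , r) ∈ H
  row∈ = ∈-++⁺ˡ ∘ ∈-map⁺ _
  col∈ : ∀ {c} → c ∈ K → (1F , c) ∈ H
  col∈ = ∈-++⁺ʳ rows ∘ ∈-++⁺ˡ ∘ ∈-map⁺ _
  sym∈ : ∀ {s} → s ∈ S ++ S′ → (2F , s) ∈ H
  sym∈ = ∈-++⁺ʳ rows ∘ ∈-++⁺ʳ cols ∘ ∈-map⁺ _

  dominated : ∀ t x → ∃[ e ] (TwoHubs Q H e × coord Q t e ≡ x)
  -- The two hubs are column and symbol for a given row, row and symbol for a given column, and row
  -- and column for a given symbol.
  dominated 0F r = let c , c∈K , s∈S = hitS r in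
    (r , c) , inj₂ (inj₂ (col∈ c∈K , sym∈ (∈-++⁺ˡ s∈S))) , refl
  dominated 1F c = let r , r∈K , s∈S′ = hitS′ c in
    (r , c) , inj₂ (inj₁ (row∈ (∈-++⁺ˡ r∈K) , sym∈ (∈-++⁺ʳ S s∈S′))) , refl
  dominated 2F s = let c , c∈K , r∈R = hitR s in
    (proj₁ (colEx Q c s) , c) , inj₁ (row∈ (∈-++⁺ʳ K r∈R) , col∈ c∈K) , proj₂ (colEx Q c s)

  ∣K∣≤ : length K ≤ k
  ∣K∣≤ = ≤-trans (≤-reflexive (length-take k (allFin n))) (m⊓n≤m k _)

  length-map-++ : ∀ (t : Fin 3) (xs ys : List (Fin n)) →
                  length (map (t ,_) (xs ++ ys)) ≡ length xs + length ys
  length-map-++ t xs ys = trans (length-map (t ,_) (xs ++ ys)) (length-++ xs)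

  ∣H∣≤ : length H ≤ 2 * k + 3 * (j * (3 * k))
  ∣H∣≤ = begin
    length H ≡⟨ trans (length-++ rows) (cong₂ _+_ (length-map-++ 0F K R)
                  (trans (length-++ cols) (cong₂ _+_ (length-map _ K) (length-map-++ 2F S S′)))) ⟩
    (length K + length R) + (length K + (length S + length S′))
      ≤⟨ +-mono-≤ (+-mono-≤ ∣K∣≤ ∣R∣≤) (+-mono-≤ ∣K∣≤ (+-mono-≤ ∣S∣≤ ∣S′∣≤)) ⟩
    (k + j * (3 * k)) + (k + (j * (3 * k) + j * (3 * k))) ≡⟨ eq k (j * (3 * k)) ⟩
    2 * k + 3 * (j * (3 * k)) ∎
    where
    open ≤-Reasoning
    eq : ∀ k x → (k + x) + (k + (x + x)) ≡ 2 * k + 3 * x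
    eq = solve-∀

-- Estimates

-- `k` is the integer square root: the upper bound says that `suc m` is below `suc k * suc k`. It
-- fails for the next number only at a perfect square, where `k` increases.
sqrt-floor : ∀ m → ∃[ k ] (1 ≤ k × k * k ≤ suc m × suc m ≤ k * k + 2 * k)
sqrt-floor zero = 1 , ≤-refl , ≤-refl , s≤s z≤n
sqrt-floor (suc m) with sqrt-floor m
... | k , 1≤k , lo , hi with suc (suc m) ≤? k * k + 2 * k
...   | yes hi′ = k , 1≤k , m≤n⇒m≤1+n lo , hi′
...   | no ¬hi′ = suc k , s≤s z≤n , ≤-trans (≤-reflexive (eq k)) (≰⇒> ¬hi′)
                , ≤-trans (s≤s hi) (≤-trans (≤-reflexive (sym (eq k))) (m≤m+n _ _))
  where
  eq : ∀ k → suc k * suc k ≡ suc (k * k + 2 * k)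
  eq = solve-∀

-- `2 ^ j` is doubled exactly when the next number reaches it. The strict lower bound feeds
-- `hit-all`; the upper one keeps `j` logarithmic.
log-ceil : ∀ m → ∃[ j ] (1 ≤ j × suc m < 2 ^ j × 2 ^ j ≤ 2 * suc m)
log-ceil zero = 1 , ≤-refl , ≤-refl , ≤-refl
log-ceil (suc m) with log-ceil m
... | j , 1≤j , lo , hi with suc (suc (suc m)) ≤? 2 ^ j
...   | yes lo′ = j , 1≤j , lo′ , ≤-trans hi (*-monoʳ-≤ 2 (n≤1+n (suc m)))
...   | no ¬lo′ = suc j , s≤s z≤n
                , <-≤-trans (m<m*n (suc (suc m)) 2 ≤-refl)
                    (≤-trans (≤-reflexive (*-comm (suc (suc m)) 2)) (*-monoʳ-≤ 2 lo))
                , *-monoʳ-≤ 2 (≤-pred (≰⇒> ¬lo′))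

1+m≤2^m : ∀ m → suc m ≤ 2 ^ m
1+m≤2^m zero = ≤-refl
1+m≤2^m (suc m) = ≤-trans (+-mono-≤ {1} {2 ^ m} (m^n>0 2 m) (1+m≤2^m m))
  (≤-reflexive (cong (2 ^ m +_) (sym (+-identityʳ _))))

^-distribʳ-* : ∀ o m n → (m * n) ^ o ≡ m ^ o * n ^ o
^-distribʳ-* zero m n = refl
^-distribʳ-* (suc o) m n = trans (cong (m * n *_) (^-distribʳ-* o m n))
  ([m*n]*[o*p]≡[m*o]*[n*p] m n (m ^ o) (n ^ o))

-- ℓ ≤ q (⌊ℓ/q⌋ + 1) ≤ q 2^⌊ℓ/q⌋; now take q-th powers.
^-≤-2^ : ∀ q .{{_ : NonZero q}} ℓ → ℓ ^ q ≤ q ^ q * 2 ^ ℓ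
^-≤-2^ q ℓ = begin
  ℓ ^ q                    ≤⟨ ^-monoˡ-≤ q ℓ≤ ⟩
  (q * 2 ^ (ℓ / q)) ^ q    ≡⟨ ^-distribʳ-* q q (2 ^ (ℓ / q)) ⟩
  q ^ q * (2 ^ (ℓ / q)) ^ q ≡⟨ cong (q ^ q *_) (^-*-assoc 2 (ℓ / q) q) ⟩
  q ^ q * 2 ^ (ℓ / q * q)  ≤⟨ *-monoʳ-≤ (q ^ q) (^-monoʳ-≤ 2 (m/n*n≤m ℓ q)) ⟩
  q ^ q * 2 ^ ℓ            ∎
  where
  open ≤-Reasoning
  ℓ≤ : ℓ ≤ q * 2 ^ (ℓ / q)
  ℓ≤ = begin
    ℓ                    ≡⟨ m≡m%n+[m/n]*n ℓ q ⟩
    ℓ % q + ℓ / q * q    ≤⟨ +-monoˡ-≤ _ (<⇒≤ (m%n<n ℓ q)) ⟩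
    suc (ℓ / q) * q      ≤⟨ *-monoˡ-≤ q (1+m≤2^m (ℓ / q)) ⟩
    2 ^ (ℓ / q) * q      ≡⟨ *-comm _ q ⟩
    q * 2 ^ (ℓ / q)      ∎

-- Write `(k * j) ^ (2 * q)` as `(k ^ 2) ^ q * (j ^ q) ^ 2`, which is at most `n ^ q * (b * n) ^ 2`.
-- The exponent 2 of `n` fits into `2 * P` and that of `b` into `2 * q`.
sizeBound-from-√log : ∀ {P q a b n k j d} .{{_ : NonZero b}} .{{_ : NonZero n}} → 1 ≤ P → 1 ≤ q →
  d ≤ a * (k * j) → k * k ≤ n → j ^ q ≤ b * n →
  d ^ (2 * q) ≤ (a * b) ^ (2 * q) * n ^ (q + 2 * P)
sizeBound-from-√log {P} {q} {a} {b} {n} {k} {j} {d} 1≤P 1≤q d≤akj kk≤n j^q≤bn = begin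
  d ^ (2 * q)                                          ≤⟨ ^-monoˡ-≤ (2 * q) d≤akj ⟩
  (a * (k * j)) ^ (2 * q)                              ≡⟨ ^-distribʳ-* (2 * q) a (k * j) ⟩
  a ^ (2 * q) * (k * j) ^ (2 * q)                      ≤⟨ *-monoʳ-≤ (a ^ (2 * q)) kj≤ ⟩
  a ^ (2 * q) * (n ^ q * (b ^ (2 * q) * n ^ (2 * P)))
    ≡⟨ regroup (a ^ (2 * q)) (n ^ q) (b ^ (2 * q)) (n ^ (2 * P)) ⟩
  a ^ (2 * q) * b ^ (2 * q) * (n ^ q * n ^ (2 * P))
    ≡⟨ cong₂ _*_ (^-distribʳ-* (2 * q) a b) (^-distribˡ-+-* n q (2 * P)) ⟨
  (a * b) ^ (2 * q) * n ^ (q + 2 * P)                  ∎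
  where
  open ≤-Reasoning
  regroup : ∀ a b c d → a * (b * (c * d)) ≡ a * c * (b * d)
  regroup = solve-∀

  kk≡k² : k * k ≡ k ^ 2
  kk≡k² = cong (k *_) (sym (*-identityʳ k))

  j^2q≡ : j ^ (2 * q) ≡ (j ^ q) ^ 2
  j^2q≡ = trans (cong (j ^_) (*-comm 2 q)) (sym (^-*-assoc j q 2))

  kj≤ : (k * j) ^ (2 * q) ≤ n ^ q * (b ^ (2 * q) * n ^ (2 * P))
  kj≤ = begin
    (k * j) ^ (2 * q)                   ≡⟨ ^-distribʳ-* (2 * q) k j ⟩
    k ^ (2 * q) * j ^ (2 * q)           ≡⟨ cong₂ _*_ (sym (^-*-assoc k 2 q)) j^2q≡ ⟩
    (k ^ 2) ^ q * (j ^ q) ^ 2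
      ≤⟨ *-mono-≤ (^-monoˡ-≤ q (subst (_≤ n) kk≡k² kk≤n)) (^-monoˡ-≤ 2 j^q≤bn) ⟩
    n ^ q * (b * n) ^ 2                 ≡⟨ cong (n ^ q *_) (^-distribʳ-* 2 b n) ⟩
    n ^ q * (b ^ 2 * n ^ 2)
      ≤⟨ *-monoʳ-≤ (n ^ q) (*-mono-≤ (^-monoʳ-≤ b (*-monoʳ-≤ 2 1≤q)) (^-monoʳ-≤ n (*-monoʳ-≤ 2 1≤P))) ⟩
    n ^ q * (b ^ (2 * q) * n ^ (2 * P)) ∎

-- Here `2 * k` counts the hubs from `K` as rows and as columns, and the rest the three hitting sets
-- of size at most `j * (3 * k)`.
2k+9jk≤11kj : ∀ k {j} → 1 ≤ j → 2 * k + 3 * (j * (3 * k)) ≤ 11 * (k * j)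
2k+9jk≤11kj k {j} 1≤j = begin
  2 * k + 3 * (j * (3 * k))       ≤⟨ +-monoˡ-≤ _ (*-monoʳ-≤ 2 (m≤m*n k j {{>-nonZero 1≤j}})) ⟩
  2 * (k * j) + 3 * (j * (3 * k)) ≡⟨ eq k j ⟩
  11 * (k * j)                    ∎
  where
  open ≤-Reasoning
  eq : ∀ k j → 2 * (k * j) + 3 * (j * (3 * k)) ≡ 11 * (k * j)
  eq = solve-∀

≤k²+2k⇒≤3k² : ∀ k {n} → 1 ≤ k → n ≤ k * k + 2 * k → n ≤ 3 * k * k
≤k²+2k⇒≤3k² k {n} 1≤k n≤ = begin
  n                   ≤⟨ n≤ ⟩
  k * k + 2 * k       ≤⟨ +-monoʳ-≤ (k * k) (*-monoʳ-≤ 2 (m≤m*n k k {{>-nonZero 1≤k}})) ⟩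
  k * k + 2 * (k * k) ≡⟨ eq k ⟩
  3 * k * k           ∎
  where
  open ≤-Reasoning
  eq : ∀ k → k * k + 2 * (k * k) ≡ 3 * k * k
  eq = solve-∀

-- A fixed power of a logarithm is at most linear, so the logarithmic factor is absorbed by the ε in
-- the exponent.
log-power≤ : ∀ q .{{_ : NonZero q}} {j n} → 2 ^ j ≤ 2 * n → j ^ q ≤ q ^ q * 2 * n
log-power≤ q {j} {n} 2^j≤2n = begin
  j ^ q           ≤⟨ ^-≤-2^ q j ⟩
  q ^ q * 2 ^ j   ≤⟨ *-monoʳ-≤ (q ^ q) 2^j≤2n ⟩
  q ^ q * (2 * n) ≡⟨ *-assoc (q ^ q) 2 n ⟨
  q ^ q * 2 * n   ∎
  where open ≤-Reasoning

-- Choice of parameters and the final bound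

minimalCover-with-sizeBound : ∀ {P q b} .{{_ : NonZero b}} → 1 ≤ P → 1 ≤ q →
  (∀ j n → 2 ^ j ≤ 2 * n → j ^ q ≤ b * n) →
  ∀ m (Q : LatinSquare (suc m)) →
  ∃[ M ] (IsMinimalCover Q M × SizeBound P q (11 * b) (suc m) (length M))
minimalCover-with-sizeBound {P} {q} {b} 1≤P 1≤q log≤ m Q with sqrt-floor m | log-ceil m
... | k , 1≤k , kk≤n , n≤ | j , 1≤j , n<2^j , 2^j≤2n =
  map₂ (λ {M} → map₂ (sizeBound M))
    (minimalCover-deficiency Q {k} {j}
      (≤-trans (m≤m*n k k {{>-nonZero 1≤k}}) kk≤n) (≤k²+2k⇒≤3k² k 1≤k n≤) n<2^j)
  where
  sizeBound : ∀ (M : List (Cell (suc m))) → 3 * suc m ∸ length M ≤ 2 * k + 3 * (j * (3 * k)) →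
              SizeBound P q (11 * b) (suc m) (length M)
  sizeBound M small = sizeBound-from-√log {P} {q} {11} {b} {suc m} {k} {j} {3 * suc m ∸ length M}
    1≤P 1≤q (≤-trans small (2k+9jk≤11kj k 1≤j)) kk≤n (log≤ j (suc m) 2^j≤2n)

theorem3p8 : (p q : ℕ) → ∃[ C ] (∀ (n : ℕ) (Q : LatinSquare n) →
    ∃[ Cv ] (IsMinimalCover Q Cv × SizeBound (suc p) (suc q) C n (length Cv)))
-- The factor 11 comes from the hub count, the other from `log-power≤` at `suc q`.
theorem3p8 p q = 11 * (suc q ^ suc q * 2) , λ where
    -- In order zero the empty list is vacuously a minimal cover, and its deficiency 0 has a
    -- positive exponent, so the left side is 0.
    zero    Q → [] , ([] , ((λ ()) , (λ ()) , (λ ())) , λ _ ()) , z≤n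
    (suc m) Q → minimalCover-with-sizeBound {suc p} {suc q} {suc q ^ suc q * 2}
      {{m*n≢0 (suc q ^ suc q) 2 {{m^n≢0 (suc q) (suc q)}}}} (s≤s z≤n) (s≤s z≤n)
      (λ j n → log-power≤ (suc q) {j} {n}) m Q
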